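{- Let $k$ be a positive integer. For all non-negative integers $m,n$ with $m>n$, $$M_{n+1}^{(k)}M_{m}^{(k)}-M_n^{(k)}M_{m+1}^{(k)}=(2^k)^{n} M_{m-n}^{(k)} .$$
   Context: The Mersenne numbers $\{M_n\}_{n\ge 0}$ are defined by $M_0=0$, $M_1=1$, $M_{n+2}=3M_{n+1}-2M_n$, i.e. $M_n=2^n-1$. For a positive integer $k$, the higher order Mersenne numbers are $M_n^{(k)}=M_{kn}/M_k$ for $n=0,1,2,\dots$. -}

module Defs where

open import Data.Integer.Base as ℤ using (ℤ; +_; 0ℤ; 1ℤ; _*_; _-_)
open import Data.Integer.GCD using (gcd)
import Data.Integer.Properties as ℤ
open import Data.Integer.Tactic.RingSolver using (solve-∀)
open import Data.Nat.Base as ℕ using (ℕ; zero; suc; _^_)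
import Data.Nat.Properties as ℕ
open import Data.Rational.Base as ℚ using (ℚ; _/_; _÷_; ↥_)
import Data.Rational.Properties as ℚ
open import Data.Sum.Base using (inj₁; inj₂)
open import Relation.Binary.PropositionalEquality

M : ℕ → ℤ
M zero          = 0ℤ
M (suc zero)    = 1ℤ
M (suc (suc n)) = + 3 * M (suc n) - + 2 * M n

M≡2^n-1 : ∀ n → M n ≡ + (2 ^ n) - 1ℤ
M≡2^n-1 zero          = refl
M≡2^n-1 (suc zero)    = refl
M≡2^n-1 (suc (suc n)) = begin
  + 3 * M (suc n) - + 2 * M n
    ≡⟨ cong₂ (λ x y → + 3 * x - + 2 * y) (M≡2^n-1 (suc n)) (M≡2^n-1 n) ⟩
  + 3 * (+ (2 ^ suc n) - 1ℤ) - + 2 * (+ (2 ^ n) - 1ℤ)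
    ≡⟨ cong (λ x → + 3 * (x - 1ℤ) - + 2 * (+ (2 ^ n) - 1ℤ)) (ℤ.pos-* 2 (2 ^ n)) ⟩
  + 3 * (+ 2 * + (2 ^ n) - 1ℤ) - + 2 * (+ (2 ^ n) - 1ℤ)
    ≡⟨ lemma (+ (2 ^ n)) ⟩
  + 2 * (+ 2 * + (2 ^ n)) - 1ℤ
    ≡⟨ cong (λ x → + 2 * x - 1ℤ) (ℤ.pos-* 2 (2 ^ n)) ⟨
  + 2 * + (2 ^ suc n) - 1ℤ
    ≡⟨ cong (_- 1ℤ) (ℤ.pos-* 2 (2 ^ suc n)) ⟨
  + (2 ^ suc (suc n)) - 1ℤ ∎
  where
  open ≡-Reasoning
  lemma : ∀ x → + 3 * (+ 2 * x - 1ℤ) - + 2 * (x - 1ℤ) ≡ + 2 * (+ 2 * x) - 1ℤ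
  lemma = solve-∀

M≢0 : ∀ k .{{_ : ℕ.NonZero k}} → M k ≢ 0ℤ
M≢0 (suc j) Mk≡0 with ℕ.m^n≡1⇒n≡0∨m≡1 2 (suc j)
  (ℤ.+-injective (ℤ.i-j≡0⇒i≡j (+ (2 ^ suc j)) 1ℤ (trans (sym (M≡2^n-1 (suc j))) Mk≡0)))
... | inj₁ ()
... | inj₂ ()

M/1-nonZero : ∀ k .{{_ : ℕ.NonZero k}} → ℚ.NonZero (M k / 1)
M/1-nonZero k = ℚ.≢-nonZero {M k / 1} λ Mk/1≡0 → M≢0 k (begin
  M k                          ≡⟨ ℚ.↥-/ (M k) 1 ⟨
  ↥ (M k / 1) * gcd (M k) 1ℤ   ≡⟨ cong (λ p → ↥ p * gcd (M k) 1ℤ) Mk/1≡0 ⟩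
  0ℤ * gcd (M k) 1ℤ            ≡⟨ ℤ.*-zeroˡ (gcd (M k) 1ℤ) ⟩
  0ℤ                           ∎)
  where open ≡-Reasoning

-- The quotient M (k n) / M k is taken exactly, in ℚ.  The nonzero witness is
-- passed by hand: ℚ.NonZero unfolds to ℕ.NonZero, so declaring M/1-nonZero an
-- instance would make it a candidate for every ℕ.NonZero constraint.
M⁽_⁾ : (k : ℕ) .{{_ : ℕ.NonZero k}} → ℕ → ℚ
M⁽ k ⁾ n = _÷_ (M (k ℕ.* n) / 1) (M k / 1) {{M/1-nonZero k}}

{-# OPTIONS --safe #-}
-- By the closed form, with q = 2^k, x = q^n and y = q^(m-n), the integer numerators
-- satisfy (q x - 1)(x y - 1) - (x - 1)(q x y - 1) = x (q - 1)(y - 1).  Dividing by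
-- (M k)² cancels the factor q - 1 = M k once.
module Submission where

open import Defs
open import Data.Integer.Base as ℤ using (ℤ; +_; 1ℤ)
import Data.Integer.Properties as ℤ
import Data.Integer.Tactic.RingSolver as ℤ-RingSolver
open import Data.Nat.Base as ℕ using (ℕ; suc; _^_; _∸_; _>_; NonZero)
import Data.Nat.Properties as ℕ
open import Data.Rational.Base using (ℚ; _*_; _-_; _/_; 1/_; 1ℚ; toℚᵘ; fromℚᵘ)
import Data.Rational.Base as ℚ
import Data.Rational.Properties as ℚ
open import Data.Rational.Solver using (module +-*-Solver)
open import Data.Rational.Unnormalised.Base as ℚᵘ using (mkℚᵘ)
import Data.Rational.Unnormalised.Properties as ℚᵘ
open import Relation.Binary.PropositionalEquality
  using (_≡_; refl; sym; trans; cong; cong₂; subst; module ≡-Reasoning)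

-- `fromℚᵘ` reduces to lowest terms, so the two sides do not match by computation. After `toℚᵘ` the
-- reduction is invisible up to `≃`, and `toℚᵘ-injective` turns `≃` back into equality.
fromℚᵘ-homo-* : ∀ p q → fromℚᵘ (p ℚᵘ.* q) ≡ fromℚᵘ p * fromℚᵘ q
fromℚᵘ-homo-* p q = ℚ.toℚᵘ-injective (begin
  toℚᵘ (fromℚᵘ (p ℚᵘ.* q))                ≈⟨ ℚ.toℚᵘ-fromℚᵘ (p ℚᵘ.* q) ⟩
  p ℚᵘ.* q                                ≈⟨ ℚᵘ.*-cong (ℚ.toℚᵘ-fromℚᵘ p) (ℚ.toℚᵘ-fromℚᵘ q) ⟨
  toℚᵘ (fromℚᵘ p) ℚᵘ.* toℚᵘ (fromℚᵘ q)    ≈⟨ ℚ.toℚᵘ-homo-* (fromℚᵘ p) (fromℚᵘ q) ⟨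
  toℚᵘ (fromℚᵘ p * fromℚᵘ q)              ∎)
  where open import Relation.Binary.Reasoning.Setoid ℚᵘ.≃-setoid

fromℚᵘ-homo-+ : ∀ p q → fromℚᵘ (p ℚᵘ.+ q) ≡ fromℚᵘ p ℚ.+ fromℚᵘ q
fromℚᵘ-homo-+ p q = ℚ.toℚᵘ-injective (begin
  toℚᵘ (fromℚᵘ (p ℚᵘ.+ q))                ≈⟨ ℚ.toℚᵘ-fromℚᵘ (p ℚᵘ.+ q) ⟩
  p ℚᵘ.+ q                                ≈⟨ ℚᵘ.+-cong (ℚ.toℚᵘ-fromℚᵘ p) (ℚ.toℚᵘ-fromℚᵘ q) ⟨
  toℚᵘ (fromℚᵘ p) ℚᵘ.+ toℚᵘ (fromℚᵘ q)    ≈⟨ ℚ.toℚᵘ-homo-+ (fromℚᵘ p) (fromℚᵘ q) ⟨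
  toℚᵘ (fromℚᵘ p ℚ.+ fromℚᵘ q)            ∎)
  where open import Relation.Binary.Reasoning.Setoid ℚᵘ.≃-setoid

-- `i / 1` is by definition `fromℚᵘ (mkℚᵘ i 0)`: `mkℚᵘ` stores the denominator minus one.
/1-homo-* : ∀ i j → (i ℤ.* j) / 1 ≡ (i / 1) * (j / 1)
/1-homo-* i j = fromℚᵘ-homo-* (mkℚᵘ i 0) (mkℚᵘ j 0)

/1-homo-+ : ∀ i j → (i ℤ.+ j) / 1 ≡ (i / 1) ℚ.+ (j / 1)
/1-homo-+ i j = trans
  -- The unnormalised sum cross-multiplies, so its numerator is `i ℤ.* 1ℤ ℤ.+ j ℤ.* 1ℤ`, which does
  -- not reduce for variable `i` and `j`.
  (cong (_/ 1) (sym (cong₂ ℤ._+_ (ℤ.*-identityʳ i) (ℤ.*-identityʳ j))))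
  (fromℚᵘ-homo-+ (mkℚᵘ i 0) (mkℚᵘ j 0))

M-*-closed : ∀ k n → M (k ℕ.* n) ≡ + ((2 ^ k) ^ n) ℤ.- 1ℤ
M-*-closed k n = trans (M≡2^n-1 (k ℕ.* n)) (cong (λ e → + e ℤ.- 1ℤ) (sym (ℕ.^-*-assoc 2 k n)))

-- Stated without subtraction, so that only sums and products have to be carried into ℚ.
M-*-determinant : ∀ k n d →
  M (k ℕ.* suc n) ℤ.* M (k ℕ.* (n ℕ.+ d)) ≡
  + ((2 ^ k) ^ n) ℤ.* (M k ℤ.* M (k ℕ.* d)) ℤ.+ M (k ℕ.* n) ℤ.* M (k ℕ.* suc (n ℕ.+ d))
M-*-determinant k n d = begin
  M (k ℕ.* suc n) ℤ.* M (k ℕ.* (n ℕ.+ d))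
    ≡⟨ cong₂ ℤ._*_ (M-*-suc n) M-*-+ ⟩
  (q ℤ.* x ℤ.- 1ℤ) ℤ.* (x ℤ.* y ℤ.- 1ℤ)
    ≡⟨ identity q x y ⟩
  x ℤ.* ((q ℤ.- 1ℤ) ℤ.* (y ℤ.- 1ℤ)) ℤ.+ (x ℤ.- 1ℤ) ℤ.* (q ℤ.* (x ℤ.* y) ℤ.- 1ℤ)
    ≡⟨ cong₂ (λ a b → x ℤ.* a ℤ.+ b)
         (cong₂ ℤ._*_ (M≡2^n-1 k) (M-*-closed k d))
         (cong₂ ℤ._*_ (M-*-closed k n)
           (trans (M-*-suc (n ℕ.+ d)) (cong (λ e → q ℤ.* e ℤ.- 1ℤ) ^-+))) ⟨
  x ℤ.* (M k ℤ.* M (k ℕ.* d)) ℤ.+ M (k ℕ.* n) ℤ.* M (k ℕ.* suc (n ℕ.+ d)) ∎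
  where
  open ≡-Reasoning
  q x y : ℤ
  q = + (2 ^ k)
  x = + ((2 ^ k) ^ n)
  y = + ((2 ^ k) ^ d)
  ^-+ : + ((2 ^ k) ^ (n ℕ.+ d)) ≡ x ℤ.* y
  ^-+ = trans (cong +_ (ℕ.^-distribˡ-+-* (2 ^ k) n d)) (ℤ.pos-* ((2 ^ k) ^ n) ((2 ^ k) ^ d))
  M-*-+ : M (k ℕ.* (n ℕ.+ d)) ≡ x ℤ.* y ℤ.- 1ℤ
  M-*-+ = trans (M-*-closed k (n ℕ.+ d)) (cong (ℤ._- 1ℤ) ^-+)
  M-*-suc : ∀ l → M (k ℕ.* suc l) ≡ q ℤ.* + ((2 ^ k) ^ l) ℤ.- 1ℤ
  M-*-suc l = trans (M-*-closed k (suc l)) (cong (ℤ._- 1ℤ) (ℤ.pos-* (2 ^ k) ((2 ^ k) ^ l)))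
  -- Quantified afresh, so that the solver sees indeterminates in place of the powers of 2.
  identity : ∀ q x y →
    (q ℤ.* x ℤ.- 1ℤ) ℤ.* (x ℤ.* y ℤ.- 1ℤ) ≡
    x ℤ.* ((q ℤ.- 1ℤ) ℤ.* (y ℤ.- 1ℤ)) ℤ.+ (x ℤ.- 1ℤ) ℤ.* (q ℤ.* (x ℤ.* y) ℤ.- 1ℤ)
  identity = ℤ-RingSolver.solve-∀

-- The left side carries `1/ z` twice and the right side once; the factor `z` in the hypothesis
-- absorbs the difference.
determinant-÷ : ∀ a b c d x y z .{{_ : ℚ.NonZero z}} →
  a * b ≡ x * (z * y) ℚ.+ c * d →
  (a ℚ.÷ z) * (b ℚ.÷ z) - (c ℚ.÷ z) * (d ℚ.÷ z) ≡ x * (y ℚ.÷ z)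
determinant-÷ a b c d x y z ab≡ = begin
  (a * w) * (b * w) - (c * w) * (d * w)
    ≡⟨ solve 5 (λ a b c d w → (a :* w) :* (b :* w) :- (c :* w) :* (d :* w)
                           := (a :* b :- c :* d) :* (w :* w)) refl a b c d w ⟩
  (a * b - c * d) * (w * w)
    ≡⟨ cong (λ e → (e - c * d) * (w * w)) ab≡ ⟩
  (x * (z * y) ℚ.+ c * d - c * d) * (w * w)
    -- To the solver `w` is a free variable, so it can only bring `z` and `w` together; the inverse
    -- law is applied in the next step.
    ≡⟨ solve 6 (λ c d x y z w → (x :* (z :* y) :+ c :* d :- c :* d) :* (w :* w)
                             := x :* (y :* w) :* (z :* w)) refl c d x y z w ⟩
  x * (y * w) * (z * w)
    ≡⟨ cong (x * (y * w) *_) (ℚ.*-inverseʳ z) ⟩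
  x * (y * w) * 1ℚ
    ≡⟨ ℚ.*-identityʳ (x * (y * w)) ⟩
  x * (y * w) ∎
  where
  open ≡-Reasoning
  open +-*-Solver
  w : ℚ
  w = 1/ z

-- Writing the larger index as `n ℕ.+ d` keeps truncated subtraction out of the computation.
M⁽⁾-determinant : (k : ℕ) .{{_ : NonZero k}} (n d : ℕ) →
  M⁽ k ⁾ (suc n) * M⁽ k ⁾ (n ℕ.+ d) - M⁽ k ⁾ n * M⁽ k ⁾ (suc (n ℕ.+ d))
    ≡ (+ ((2 ^ k) ^ n) / 1) * M⁽ k ⁾ d
-- Each `M⁽ k ⁾` unfolds to a quotient by `M k / 1`, which serves as `z`; what remains is to carry
-- the integer identity into ℚ.
M⁽⁾-determinant k n d = determinant-÷ (A / 1) (B / 1) (C / 1) (D / 1) (X / 1) (Y / 1) (M k / 1) {{M/1-nonZero k}} (begin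
  (A / 1) * (B / 1)                                       ≡⟨ /1-homo-* A B ⟨
  (A ℤ.* B) / 1                                           ≡⟨ cong (_/ 1) (M-*-determinant k n d) ⟩
  (X ℤ.* (M k ℤ.* Y) ℤ.+ C ℤ.* D) / 1                     ≡⟨ /1-homo-+ (X ℤ.* (M k ℤ.* Y)) (C ℤ.* D) ⟩
  (X ℤ.* (M k ℤ.* Y)) / 1 ℚ.+ (C ℤ.* D) / 1               ≡⟨ cong₂ ℚ._+_ (/1-homo-* X (M k ℤ.* Y)) (/1-homo-* C D) ⟩
  (X / 1) * ((M k ℤ.* Y) / 1) ℚ.+ (C / 1) * (D / 1)       ≡⟨ cong (λ e → (X / 1) * e ℚ.+ (C / 1) * (D / 1)) (/1-homo-* (M k) Y) ⟩
  (X / 1) * ((M k / 1) * (Y / 1)) ℚ.+ (C / 1) * (D / 1)   ∎)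
  where
  open ≡-Reasoning
  A B C D X Y : ℤ
  A = M (k ℕ.* suc n)
  B = M (k ℕ.* (n ℕ.+ d))
  C = M (k ℕ.* n)
  D = M (k ℕ.* suc (n ℕ.+ d))
  X = + ((2 ^ k) ^ n)
  Y = M (k ℕ.* d)

theorem2p10 : (k : ℕ) .{{_ : NonZero k}} (m n : ℕ) → m > n →
    M⁽ k ⁾ (suc n) * M⁽ k ⁾ m - M⁽ k ⁾ n * M⁽ k ⁾ (suc m) ≡ (+ ((2 ^ k) ^ n) / 1) * M⁽ k ⁾ (m ∸ n)
theorem2p10 k m n m>n = subst
  -- Only the indices on the left are abstracted: `n ℕ.+ (m ∸ n)` becomes `m` there, while `m ∸ n`
  -- on the right stays fixed.
  (λ l → M⁽ k ⁾ (suc n) * M⁽ k ⁾ l - M⁽ k ⁾ n * M⁽ k ⁾ (suc l) ≡ (+ ((2 ^ k) ^ n) / 1) * M⁽ k ⁾ (m ∸ n))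
  (ℕ.m+[n∸m]≡n (ℕ.<⇒≤ m>n))
  (M⁽⁾-determinant k n (m ∸ n))
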